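{- Let $k\geq 2$ and let $G$ be a (simple) graph of order $n\geq \frac{11}{2}k^2+2k-\frac{3}{2}$. If $e(G)>(k-\frac{3}{2})n$, then $G$ contains $k\cdot P_3$ as a subgraph unless one of the following holds: (i) $G\subseteq F_{n,k}$; (ii) $G\subseteq F_{n,k-1}(K_h)$ for some $h$ with $4\leq h\leq 5$; (iii) $G\subseteq F_{n,k-1}(N_6)$.
   Context: All graphs are finite and simple; $e(G)$ is the number of edges of $G$. $P_m$ is the path on $m$ vertices, $K_m$ the complete graph on $m$ vertices ($K_0$ and $K_s$ with $s=0$ denote the empty graph), and $k\cdot G$ is the disjoint union of $k$ copies of $G$. For disjoint graphs $G,H$, $G\cup H$ is their disjoint union and $G\nabla H$ is their join (the union together with all edges between $V(G)$ and $V(H)$). $G\subseteq H$ means $G$ is isomorphic to a subgraph of $H$. For a connected graph $H$ of order $h\ge 2$, an integer $k\ge 1$ and $n>k+h-1$, define $F_{n,k}(H)=K_{k-1}\nabla(H\cup p\cdot K_2\cup K_s)$, where $n-(k+h-1)=2p+s$ with $0\leq s<2$; write $F_{n,k}=F_{n,k}(K_2)$. $N_6$ is the graph on 6 vertices obtained from a triangle $K_3$ by attaching one pendant edge to each of its three vertices. -}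

module Defs where

open import Data.Nat using (ℕ; zero; suc; _+_; _*_; _∸_; _<ᵇ_; _/_; _%_)
open import Data.Bool using (Bool; true; false; _∧_; _∨_; not; if_then_else_)
open import Data.Bool.Properties using (∧-zeroʳ; ∨-comm; ∧-comm)
open import Data.Fin using (Fin; toℕ; zero; suc) renaming (_≟_ to _≟ᶠ_)

open import Data.List using (List; []; _∷_; map)
open import Data.Nat.ListAction using (sum)
open import Data.List using (allFin) public
open import Data.Product using (Σ; _×_; _,_)
open import Data.Sum using (_⊎_; inj₁; inj₂)
open import Function.Definitions using (Injective)
open import Relation.Nullary.Decidable using (⌊_⌋; yes; no)
open import Relation.Binary.PropositionalEquality using (_≡_; refl; sym; cong)

record Graph (V : Set) : Set where
  field
    adj    : V → V → Bool
    adj-sym : ∀ u v → adj u v ≡ adj v u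
    irrefl  : ∀ v → adj v v ≡ false
open Graph public

_⊆ᴳ_ : {V W : Set} → Graph V → Graph W → Set
_⊆ᴳ_ {V} {W} G H =
  Σ (V → W) λ f → Injective _≡_ _≡_ f ×
    (∀ u v → adj G u v ≡ true → adj H (f u) (f v) ≡ true)

e : {n : ℕ} → Graph (Fin n) → ℕ
e {n} G = sum (map (λ i → sum (map (λ j →
            if (toℕ i <ᵇ toℕ j) ∧ adj G i j then 1 else 0) (allFin n))) (allFin n))

K : (m : ℕ) → Graph (Fin m)
K m = record { adj = λ i j → not ⌊ i ≟ᶠ j ⌋ ; adj-sym = s ; irrefl = ir }
  where
  s : ∀ i j → not ⌊ i ≟ᶠ j ⌋ ≡ not ⌊ j ≟ᶠ i ⌋
  s i j with i ≟ᶠ j | j ≟ᶠ i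
  ... | yes _ | yes _ = refl
  ... | no _  | no _  = refl
  ... | yes p | no q  with q (sym p)
  ... | ()
  s i j | no q | yes p with q (sym p)
  ... | ()
  ir : ∀ i → not ⌊ i ≟ᶠ i ⌋ ≡ false
  ir i with i ≟ᶠ i
  ... | yes _ = refl
  ... | no q with q refl
  ... | ()

_∪ᴳ_ : {V W : Set} → Graph V → Graph W → Graph (V ⊎ W)
_∪ᴳ_ {V} {W} G H = record { adj = a ; adj-sym = s ; irrefl = ir }
  where
  a : V ⊎ W → V ⊎ W → Bool
  a (inj₁ u) (inj₁ v) = adj G u v
  a (inj₂ u) (inj₂ v) = adj H u v
  a _ _ = false
  s : ∀ u v → a u v ≡ a v u
  s (inj₁ u) (inj₁ v) = Graph.adj-sym G u v
  s (inj₂ u) (inj₂ v) = Graph.adj-sym H u v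
  s (inj₁ u) (inj₂ v) = refl
  s (inj₂ u) (inj₁ v) = refl
  ir : ∀ v → a v v ≡ false
  ir (inj₁ v) = irrefl G v
  ir (inj₂ v) = irrefl H v

_∇_ : {V W : Set} → Graph V → Graph W → Graph (V ⊎ W)
_∇_ {V} {W} G H = record { adj = a ; adj-sym = s ; irrefl = ir }
  where
  a : V ⊎ W → V ⊎ W → Bool
  a (inj₁ u) (inj₁ v) = adj G u v
  a (inj₂ u) (inj₂ v) = adj H u v
  a _ _ = true
  s : ∀ u v → a u v ≡ a v u
  s (inj₁ u) (inj₁ v) = Graph.adj-sym G u v
  s (inj₂ u) (inj₂ v) = Graph.adj-sym H u v
  s (inj₁ u) (inj₂ v) = refl
  s (inj₂ u) (inj₁ v) = refl
  ir : ∀ v → a v v ≡ false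
  ir (inj₁ v) = irrefl G v
  ir (inj₂ v) = irrefl H v

_·ᴳ_ : {V : Set} → (k : ℕ) → Graph V → Graph (Fin k × V)
_·ᴳ_ {V} k G = record { adj = a ; adj-sym = s ; irrefl = ir }
  where
  a : Fin k × V → Fin k × V → Bool
  a (x , u) (y , v) = ⌊ x ≟ᶠ y ⌋ ∧ adj G u v
  s : ∀ u v → a u v ≡ a v u
  s (x , u) (y , v) rewrite Graph.adj-sym G u v with x ≟ᶠ y | y ≟ᶠ x
  ... | yes _ | yes _ = refl
  ... | no _  | no _  = refl
  ... | yes p | no q  with q (sym p)
  ... | ()
  s (x , u) (y , v) | no q | yes p with q (sym p)
  ... | ()
  ir : ∀ v → a v v ≡ false
  ir (x , u) rewrite irrefl G u = ∧-zeroʳ _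

private
  memb : ℕ → ℕ → List (ℕ × ℕ) → Bool
  memb a b [] = false
  memb a b ((c , d) ∷ es) = (⌊ a Data.Nat.≟ c ⌋ ∧ ⌊ b Data.Nat.≟ d ⌋) ∨ memb a b es

  edgeAdj : {m : ℕ} → List (ℕ × ℕ) → Fin m → Fin m → Bool
  edgeAdj es i j = memb (toℕ i) (toℕ j) es ∨ memb (toℕ j) (toℕ i) es

  edgeAdj-sym : {m : ℕ} (es : List (ℕ × ℕ)) (i j : Fin m) → edgeAdj es i j ≡ edgeAdj es j i
  edgeAdj-sym es i j = ∨-comm (memb (toℕ i) (toℕ j) es) (memb (toℕ j) (toℕ i) es)

P₃ : Graph (Fin 3)
P₃ = record { adj = edgeAdj es ; adj-sym = edgeAdj-sym es ; irrefl = ir }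
  where
  es : List (ℕ × ℕ)
  es = (0 , 1) ∷ (1 , 2) ∷ []
  ir : ∀ v → edgeAdj es v v ≡ false
  ir zero = refl
  ir (suc zero) = refl
  ir (suc (suc zero)) = refl

N₆ : Graph (Fin 6)
N₆ = record { adj = edgeAdj es ; adj-sym = edgeAdj-sym es ; irrefl = ir }
  where
  es : List (ℕ × ℕ)
  es = (0 , 1) ∷ (1 , 2) ∷ (0 , 2) ∷ (0 , 3) ∷ (1 , 4) ∷ (2 , 5) ∷ []
  ir : ∀ v → edgeAdj es v v ≡ false
  ir zero = refl
  ir (suc zero) = refl
  ir (suc (suc zero)) = refl
  ir (suc (suc (suc zero))) = refl
  ir (suc (suc (suc (suc zero)))) = refl
  ir (suc (suc (suc (suc (suc zero))))) = refl

-- F_{n,k}(H) = K_{k-1} ∇ (H ∪ p·K_2 ∪ K_s),  n - (k + h - 1) = 2p + s, 0 ≤ s < 2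
Fp : (n k h : ℕ) → ℕ
Fp n k h = (n ∸ (k + h ∸ 1)) / 2

Fs : (n k h : ℕ) → ℕ
Fs n k h = (n ∸ (k + h ∸ 1)) % 2

F : (n k : ℕ) {h : ℕ} → Graph (Fin h) →
    Graph (Fin (k ∸ 1) ⊎ (Fin h ⊎ ((Fin (Fp n k h) × Fin 2) ⊎ Fin (Fs n k h))))
F n k {h} H = K (k ∸ 1) ∇ (H ∪ᴳ ((Fp n k h ·ᴳ K 2) ∪ᴳ K (Fs n k h)))

F₂ : (n k : ℕ) → Graph (Fin (k ∸ 1) ⊎ (Fin 2 ⊎ ((Fin (Fp n k 2) × Fin 2) ⊎ Fin (Fs n k 2))))
F₂ n k = F n k (K 2)

{-# OPTIONS --safe #-}
-- Induction on k.  A maximal family of disjoint P₃'s leaves a graph of maximum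
-- degree at most one, so for k ≥ 3 a graph without k·P₃ whose degrees are all at
-- most 3k - 2 has at most 3(k-1)(3k-2) + n/2 edges, too few.  Hence some vertex v
-- has degree at least 3k - 1; every (k-1)·P₃ in G - v extends by a P₃ centred at v,
-- so G - v falls under the case k - 1 and v joins the clique of F.  If G has no
-- 2·P₃, then either some vertex meets every P₃ (i), or the only component with more
-- than one edge has at most five vertices (ii) or is the net N₆ (iii).
module Submission where

open import Defs
open import Data.Bool using (true; false; if_then_else_; _∧_)
open import Data.Empty using (⊥-elim)
open import Data.Fin using (Fin; zero; suc; toℕ)
open import Data.Fin.Properties using (_≟_; suc-injective)
open import Data.List using (List; []; _∷_; [_]; _++_; length; map; take; drop)
open import Data.List.Membership.Propositional using (_∈_; find)
open import Data.List.Membership.Propositional.Properties using (∈-∃++; ∈-map⁻; ∈-allFin)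
open import Data.List.Properties using (length-++; length-map; map-cong-local; length-tabulate; map-++; map-∘)
open import Data.List.Relation.Binary.Permutation.Propositional using (_↭_; refl; prep; swap; trans; ↭-reflexive; ↭⇒↭ₛ)
open import Data.List.Relation.Binary.Permutation.Propositional.Properties using (All-resp-↭; ∈-resp-↭; ↭-length; map⁺; ++⁺ˡ; ++⁺ʳ; ++-comm; shift; shifts)
open import Data.List.Relation.Unary.All as All using (All; []; _∷_)
open import Data.List.Relation.Unary.All.Properties using (¬Any⇒All¬) renaming (map⁺ to All-map⁺; map⁻ to All-map⁻; ++⁺ to All-++⁺; ++⁻ˡ to All-++⁻ˡ)
open import Data.List.Relation.Unary.AllPairs as AllPairs using (AllPairs; []; _∷_)
open import Data.List.Relation.Unary.AllPairs.Properties using (tabulate⁺-<) renaming (map⁺ to AllPairs-map⁺; ++⁺ to AllPairs-++⁺)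
open import Data.List.Relation.Unary.Any using (here; there; any?)
open import Data.List.Relation.Unary.Unique.Propositional using (Unique)
open import Data.List.Relation.Unary.Unique.Propositional.Properties using (allFin⁺)
import Data.List.Relation.Binary.Permutation.Setoid.Properties as PermSetoid
open import Data.Nat using (ℕ; zero; suc; _+_; _*_; _∸_; _≤_; _<_; _<ᵇ_; _/_; _%_; z≤n; s≤s; s≤s⁻¹; _<?_)
open import Data.Nat.DivMod using (m≡m%n+[m/n]*n; m%n<n)
open import Data.Nat.ListAction using (sum)
open import Data.Nat.ListAction.Properties using (sum-↭; sum-++)
open import Data.Nat.Properties hiding (_≟_; suc-injective)
open import Data.Nat.Tactic.RingSolver using (solve-∀)
open import Data.Product using (Σ; ∃; ∃₂; _×_; _,_; proj₁; proj₂; map₂)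
open import Data.Sum using (_⊎_; inj₁; inj₂; [_,_]′)
open import Data.Sum.Properties using (inj₁-injective; inj₂-injective)
open import Function using (_∘_; id; const)
open import Relation.Binary.PropositionalEquality using (_≡_; _≢_; refl; sym; cong; cong₂; subst; subst₂; setoid; module ≡-Reasoning) renaming (trans to ≡-trans)
open import Relation.Nullary using (¬_; yes; no; contradiction)

-- Permutations of lists with an explicit prefix

-- Both k and the vertex set shrink in the induction, and deleting a vertex from a graph on `Fin n`
-- would force a relabelling. So G stays fixed and the argument runs over lists of its vertices: G -
-- v is a list `L′` with `L ↭ v ∷ L′`, and a search returns a permutation that brings what it found
-- to the front. The hypothesis on n is quadratic in k, but the induction carries only 24 + 18j,
-- which is 18k - 12 for k = j + 2. This bound falls by 18 when one vertex is lost, and at k = 3 its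
-- value 42 is exactly what the edge count demands. For k = 2 a configuration is grown by asking its
-- vertices for neighbours outside. A neighbour found gives two disjoint P₃'s or a larger
-- configuration; if there is none, the configuration is cut off from the rest, which must then be a
-- matching. Both alternatives of an outcome are positive data, so the negated hypotheses of the
-- theorem enter only at its very end.

module _ {A : Set} where

  -- An index past the end yields the last entry, so `arrange` is a permutation for every list of
  -- indices and no bounds have to be proved.
  extract : ℕ → A → List A → A × List A
  extract zero    x xs       = x , xs
  extract (suc i) x []       = x , []
  extract (suc i) x (y ∷ ys) = map₂ (x ∷_) (extract i y ys)

  -- Indices always refer to the original list; `used` holds those already taken.
  position : List ℕ → ℕ → ℕ
  position []         i = i
  position (u ∷ used) i = position used i ∸ (if u <ᵇ i then 1 else 0)

  arrange : List ℕ → List ℕ → List A → List A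
  arrange used []       xs       = xs
  arrange used (i ∷ is) []       = []
  arrange used (i ∷ is) (x ∷ xs) =
    proj₁ (extract (position used i) x xs) ∷ arrange (i ∷ used) is (proj₂ (extract (position used i) x xs))

  extract-↭ : ∀ i x xs → x ∷ xs ↭ proj₁ (extract i x xs) ∷ proj₂ (extract i x xs)
  extract-↭ zero    x xs       = refl
  extract-↭ (suc i) x []       = refl
  extract-↭ (suc i) x (y ∷ ys) = trans (prep x (extract-↭ i y ys)) (swap x _ refl)

  arrange-↭ : ∀ used is xs → xs ↭ arrange used is xs
  arrange-↭ used []       xs       = refl
  arrange-↭ used (i ∷ is) []       = refl
  arrange-↭ used (i ∷ is) (x ∷ xs) =
    trans (extract-↭ (position used i) x xs) (prep _ (arrange-↭ (i ∷ used) is _))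

  -- On a list with an explicit prefix `arrange` computes, so a literal index list names the
  -- vertices to bring to the front.
  reorder : ∀ is {xs ys : List A} → xs ↭ ys → xs ↭ arrange [] is ys
  reorder is σ = trans σ (arrange-↭ [] is _)

  -- A neighbour that `neighbour?` finds behind `k` named vertices thereby receives index `k`.
  within : ∀ k {xs ys zs : List A} → xs ↭ ys → drop k ys ↭ zs → xs ↭ take k ys ++ zs
  within zero    σ ρ = trans σ ρ
  within (suc k) {ys = []}     σ ρ = trans σ ρ
  within (suc k) {ys = y ∷ ys} σ ρ = trans σ (prep y (within k refl ρ))

  ∈-front : ∀ {x : A} {xs} → x ∈ xs → ∃ λ ys → xs ↭ x ∷ ys
  ∈-front x∈xs with ys , zs , refl ← ∈-∃++ x∈xs = ys ++ zs , shift _ ys zs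

AllPairs-++⁻ˡ : ∀ {A : Set} {R : A → A → Set} xs {ys} → AllPairs R (xs ++ ys) → AllPairs R xs
AllPairs-++⁻ˡ []       _          = []
AllPairs-++⁻ˡ (x ∷ xs) (px ∷ pxs) = All-++⁻ˡ xs px ∷ AllPairs-++⁻ˡ xs pxs

-- Numerical estimates

size-step : ∀ j m → 24 + 18 * suc j ≤ suc m → 24 + 18 * j ≤ m
size-step j m N≤m = s≤s⁻¹ (≤-trans (m≤n+m _ 17) (≤-trans (≤-reflexive (lemma j)) N≤m))
  where
  lemma : ∀ j → 17 + (1 + (24 + 18 * j)) ≡ 24 + 18 * suc j
  lemma = solve-∀

-- Here `1 + 2 * j` is 2k - 3 for k = j + 2. The threshold falls by 2m + 2j + 3 when k and the order
-- `suc m` both drop by one, while deleting a vertex of degree d costs the doubled edge count only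
-- 2d, at most 2m.
edge-step : ∀ j m d q → d ≤ m → (1 + 2 * suc j) * suc m < 2 * (d + q) → (1 + 2 * j) * m < 2 * q
edge-step j m d q d≤m many = +-cancelˡ-< (2 * m) _ _ (begin-strict
  2 * m + (1 + 2 * j) * m                ≤⟨ m≤n+m _ (3 + 2 * j) ⟩
  3 + 2 * j + (2 * m + (1 + 2 * j) * m)  ≡⟨ lemma j m ⟩
  (1 + 2 * suc j) * suc m                <⟨ many ⟩
  2 * (d + q)                            ≤⟨ *-monoʳ-≤ 2 (+-monoˡ-≤ q d≤m) ⟩
  2 * (m + q)                            ≡⟨ *-distribˡ-+ 2 m q ⟩
  2 * m + 2 * q                          ∎)
  where
  open ≤-Reasoning
  lemma : ∀ j m → 3 + 2 * j + (2 * m + (1 + 2 * j) * m) ≡ (1 + 2 * suc j) * suc m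
  lemma = solve-∀

-- For k = j + 3: 3(k - 1) vertices of degree at most 3k - 2, together with a matching on the
-- others, carry too few edges. The slack 18j² + 42j vanishes at k = 3, where the bound on `m` is
-- sharp for this estimate.
edge-bound : ∀ j m → 24 + 18 * suc j ≤ m →
  2 * ((2 + j) * 3 * ((2 + j) * 3 + 1)) + m ≤ (1 + 2 * suc j) * m
edge-bound j m N≤m = begin
  2 * ((2 + j) * 3 * ((2 + j) * 3 + 1)) + m                            ≤⟨ +-monoˡ-≤ m (m≤m+n _ (18 * j * j + 42 * j)) ⟩
  2 * ((2 + j) * 3 * ((2 + j) * 3 + 1)) + (18 * j * j + 42 * j) + m    ≡⟨ cong (_+ m) (lemma j) ⟩
  2 * suc j * (24 + 18 * suc j) + m                                    ≤⟨ +-monoˡ-≤ m (*-monoʳ-≤ (2 * suc j) N≤m) ⟩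
  2 * suc j * m + m                                                    ≡⟨ +-comm (2 * suc j * m) m ⟩
  (1 + 2 * suc j) * m                                                  ∎
  where
  open ≤-Reasoning
  lemma : ∀ j → 2 * ((2 + j) * 3 * ((2 + j) * 3 + 1)) + (18 * j * j + 42 * j) ≡ 2 * suc j * (24 + 18 * suc j)
  lemma = solve-∀

size-start : ∀ j n → 11 * (2 + j) * (2 + j) + 4 * (2 + j) ∸ 3 ≤ 2 * n → 24 + 18 * j ≤ n
size-start j n large = *-cancelˡ-≤ 2 (begin
  2 * (24 + 18 * j)                                       ≤⟨ m≤m+n _ (11 * j * j + 12 * j + 1) ⟩
  2 * (24 + 18 * j) + (11 * j * j + 12 * j + 1)           ≡⟨ m+n∸n≡m _ 3 ⟨
  2 * (24 + 18 * j) + (11 * j * j + 12 * j + 1) + 3 ∸ 3   ≡⟨ cong (_∸ 3) (lemma j) ⟩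
  11 * (2 + j) * (2 + j) + 4 * (2 + j) ∸ 3                ≤⟨ large ⟩
  2 * n                                                   ∎)
  where
  open ≤-Reasoning
  lemma : ∀ j → 2 * (24 + 18 * j) + (11 * j * j + 12 * j + 1) + 3 ≡ 11 * (2 + j) * (2 + j) + 4 * (2 + j)
  lemma = solve-∀

-- Paths, matchings and degrees

-- An embedding is built as a list of vertex-image pairs. `AllPairs` of this relation yields
-- injectivity and preservation of edges together; symmetry of both graphs supplies the opposite
-- order of each pair.
Embeds : {V W : Set} → Graph V → Graph W → V × W → V × W → Set
Embeds G H (u , x) (v , y) = x ≢ y × (adj G u v ≡ true → adj H x y ≡ true)

K-adjacent : ∀ {m} {i j : Fin m} → i ≢ j → adj (K m) i j ≡ true
K-adjacent {i = i} {j} i≢j with i ≟ j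
... | yes i≡j = contradiction i≡j i≢j
... | no _    = refl

module _ {V : Set} (G : Graph V) where

  infix 4 _~_ _≁_

  _~_ _≁_ : V → V → Set
  u ~ v = adj G u v ≡ true
  u ≁ v = adj G u v ≡ false

  _˘ : ∀ {b u v} → adj G u v ≡ b → adj G v u ≡ b
  _˘ {u = u} {v} uv = ≡-trans (adj-sym G v u) uv

  ≁⇒¬~ : ∀ {u v} {A : Set} → u ≁ v → u ~ v → A
  ≁⇒¬~ u≁v u~v with () ← ≡-trans (sym u~v) u≁v

  adjacent? : ∀ u v → u ~ v ⊎ u ≁ v
  adjacent? u v with adj G u v
  ... | true  = inj₁ refl
  ... | false = inj₂ refl

  neighbour? : ∀ u L → (∃₂ λ v R → L ↭ v ∷ R × u ~ v) ⊎ All (u ≁_) L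
  neighbour? u []      = inj₂ []
  neighbour? u (v ∷ L) with adjacent? u v | neighbour? u L
  ... | inj₁ u~v | _                       = inj₁ (v , L , refl , u~v)
  ... | inj₂ _   | inj₁ (w , R , σ , u~w) = inj₁ (w , v ∷ R , trans (prep v σ) (swap v w refl) , u~w)
  ... | inj₂ u≁v | inj₂ u≁L                = inj₂ (u≁v ∷ u≁L)

  data Path (L : List V) : Set where
    path : ∀ {a b c R} → L ↭ a ∷ b ∷ c ∷ R → a ~ b → b ~ c → Path L

  Path-resp-↭ : ∀ {L L′} → L ↭ L′ → Path L′ → Path L
  Path-resp-↭ σ (path τ ab bc) = path (trans σ τ) ab bc

  Path-++ʳ : ∀ {L} B → Path L → Path (B ++ L)
  Path-++ʳ B (path τ ab bc) =
    path (trans (++⁺ˡ B τ) (++-comm B _)) ab bc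

  -- Every edge joins the entries at positions 2i and 2i + 1 for some i.
  data Paired : List V → Set where
    []   : Paired []
    [-]  : ∀ {x} → Paired [ x ]
    pair : ∀ {x y L} → All (x ≁_) L → All (y ≁_) L → Paired L → Paired (x ∷ y ∷ L)

  Matching : List V → Set
  Matching L = ∃ λ M → L ↭ M × Paired M

  -- An isolated vertex goes to the end, since in front it would change the parity of all positions
  -- and split the pairs.
  Paired-∷ʳ : ∀ {x M} → All (x ≁_) M → Paired M → Paired (M ++ [ x ])
  Paired-∷ʳ _                   []             = [-]
  Paired-∷ʳ _                   [-]            = pair [] [] []
  Paired-∷ʳ (x≁y ∷ x≁z ∷ x≁M) (pair y≁ z≁ m) =
    pair (All-++⁺ y≁ (x≁y ˘ ∷ [])) (All-++⁺ z≁ (x≁z ˘ ∷ [])) (Paired-∷ʳ x≁M m)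

  Matching-pair : ∀ {x y L} → All (x ≁_) L → All (y ≁_) L → Matching L → Matching (x ∷ y ∷ L)
  Matching-pair x≁ y≁ (M , σ , m) =
    _ , prep _ (prep _ σ) , pair (All-resp-↭ σ x≁) (All-resp-↭ σ y≁) m

  -- Once x ~ y, any further neighbour of x or y completes a P₃; otherwise x and y are cut off and
  -- form a pair. The bound `s` drives the recursion because `R` is not structurally part of the
  -- list.
  path⊎matching : ∀ L → Path L ⊎ Matching L
  path⊎matching L = go (length L) L ≤-refl
    where
    go : ∀ s L → length L ≤ s → Path L ⊎ Matching L
    go s       []      _         = inj₂ ([] , refl , [])
    go (suc s) (x ∷ L) (s≤s L≤s) with neighbour? x L
    ... | inj₂ x≁L with go s L L≤s
    ...   | inj₁ p           = inj₁ (Path-++ʳ [ x ] p)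
    ...   | inj₂ (M , σ , m) = inj₂ (M ++ [ x ] , trans (prep x σ) (++-comm [ x ] M) , Paired-∷ʳ (All-resp-↭ σ x≁L) m)
    go (suc s) (x ∷ L) (s≤s L≤s) | inj₁ (y , R , σ , x~y) with neighbour? x R | neighbour? y R
    ... | inj₁ (z , _ , ρ , x~z) | _ =
      inj₁ (path (reorder (1 ∷ 0 ∷ 2 ∷ []) (trans (prep x σ) (prep x (prep y ρ)))) (x~y ˘) x~z)
    ... | inj₂ _ | inj₁ (z , _ , ρ , y~z) =
      inj₁ (path (trans (prep x σ) (prep x (prep y ρ))) x~y y~z)
    ... | inj₂ x≁R | inj₂ y≁R with go s R (≤-trans (n≤1+n _) (≤-trans (≤-reflexive (sym (↭-length σ))) L≤s))
    ...   | inj₁ p = inj₁ (Path-resp-↭ (prep x σ) (Path-++ʳ (x ∷ y ∷ []) p))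
    ...   | inj₂ m with N , ρ , n ← Matching-pair x≁R y≁R m = inj₂ (N , trans (prep x σ) ρ , n)

  -- Packings of disjoint P₃'s

  data Paths : ℕ → List V → Set where
    []   : Paths 0 []
    path : ∀ {k a b c L} → a ~ b → b ~ c → Paths k L → Paths (suc k) (a ∷ b ∷ c ∷ L)

  Packing : ℕ → List V → Set
  Packing k L = ∃₂ λ X R → L ↭ X ++ R × Paths k X

  Packing-suc : ∀ {k L a b c R} → L ↭ a ∷ b ∷ c ∷ R → a ~ b → b ~ c → Packing k R → Packing (suc k) L
  Packing-suc {a = a} {b} {c} σ ab bc (X , R , τ , ps) =
    a ∷ b ∷ c ∷ X , R , trans σ (prep a (prep b (prep c τ))) , path ab bc ps

  Path⇒Packing : ∀ {L} → Path L → Packing 1 L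
  Path⇒Packing (path σ ab bc) = Packing-suc σ ab bc ([] , _ , refl , [])

  length-Paths : ∀ {k X} → Paths k X → length X ≡ k * 3
  length-Paths []             = refl
  length-Paths (path _ _ ps) = cong (3 +_) (length-Paths ps)

  -- Degrees and edge counts

  deg : V → List V → ℕ
  deg v L = sum (map (λ w → if adj G v w then 1 else 0) L)

  edges : List V → ℕ
  edges []      = 0
  edges (v ∷ L) = deg v L + edges L

  deg-↭ : ∀ v {L L′} → L ↭ L′ → deg v L ≡ deg v L′
  deg-↭ v σ = sum-↭ (map⁺ _ σ)

  deg-++ : ∀ v L L′ → deg v (L ++ L′) ≡ deg v L + deg v L′
  deg-++ v L L′ = ≡-trans (cong sum (map-++ _ L L′)) (sum-++ (map _ L) _)

  deg-≁ : ∀ {v L} → All (v ≁_) L → deg v L ≡ 0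
  deg-≁ []           = refl
  deg-≁ (v≁x ∷ v≁L) rewrite v≁x = deg-≁ v≁L

  deg≤1+ : ∀ v w L → deg v (w ∷ L) ≤ suc (deg v L)
  deg≤1+ v w L with adj G v w
  ... | true  = ≤-refl
  ... | false = n≤1+n _

  deg≤length : ∀ v L → deg v L ≤ length L
  deg≤length v []      = z≤n
  deg≤length v (w ∷ L) = ≤-trans (deg≤1+ v w L) (s≤s (deg≤length v L))

  edges-↭ : ∀ {L L′} → L ↭ L′ → edges L ≡ edges L′
  edges-↭ refl         = refl
  edges-↭ (prep x σ)   = cong₂ _+_ (deg-↭ x σ) (edges-↭ σ)
  edges-↭ (trans σ τ)  = ≡-trans (edges-↭ σ) (edges-↭ τ)
  edges-↭ (swap {ys = L′} x y σ)
    rewrite adj-sym G x y | deg-↭ x σ | deg-↭ y σ | edges-↭ σ =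
    lemma (if adj G y x then 1 else 0) (deg x L′) (deg y L′) (edges L′)
    where
    lemma : ∀ a b c d → (a + b) + (c + d) ≡ (a + c) + (b + d)
    lemma = solve-∀

  edges-Paired : ∀ {M} → Paired M → 2 * edges M ≤ length M
  edges-Paired []  = z≤n
  edges-Paired [-] = z≤n
  edges-Paired (pair {x} {y} {M} x≁ y≁ m) = begin
    2 * (deg x (y ∷ M) + (deg y M + edges M)) ≤⟨ *-monoʳ-≤ 2 (+-monoˡ-≤ _ (deg≤1+ x y M)) ⟩
    2 * (suc (deg x M) + (deg y M + edges M)) ≡⟨ cong (2 *_) (cong₂ _+_ (cong suc (deg-≁ x≁)) (cong (_+ edges M) (deg-≁ y≁))) ⟩
    2 * (1 + edges M)                         ≡⟨ *-distribˡ-+ 2 1 (edges M) ⟩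
    2 + 2 * edges M                           ≤⟨ +-monoʳ-≤ 2 (edges-Paired m) ⟩
    2 + length M                              ∎
    where open ≤-Reasoning

  -- Every edge not inside `R` has an end in `X` and is charged to the first such end.
  edges-++ : ∀ D X R → All (λ x → deg x (X ++ R) ≤ D) X → edges (X ++ R) ≤ length X * D + edges R
  edges-++ D []      R _          = ≤-refl
  edges-++ D (x ∷ X) R (x≤D ∷ X≤D) = begin
    deg x (X ++ R) + edges (X ++ R)  ≤⟨ +-mono-≤ (≤-trans (m≤n+m _ _) x≤D) (edges-++ D X R (All.map (≤-trans (m≤n+m _ _)) X≤D)) ⟩
    D + (length X * D + edges R)     ≡⟨ +-assoc D _ _ ⟨
    D + length X * D + edges R       ∎
    where open ≤-Reasoning

  neighbour : ∀ v L → 1 ≤ deg v L → ∃₂ λ w R → L ↭ w ∷ R × v ~ w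
  neighbour v L 1≤d with neighbour? v L
  ... | inj₁ w   = w
  ... | inj₂ v≁L = contradiction (deg-≁ v≁L) (>⇒≢ 1≤d)

  two-neighbours : ∀ v L → 2 ≤ deg v L → ∃₂ λ a b → ∃ λ R → L ↭ a ∷ b ∷ R × v ~ a × v ~ b
  two-neighbours v L 2≤d with a , R , σ , va ← neighbour v L (≤-trans (n≤1+n 1) 2≤d)
    with b , R′ , τ , vb ← neighbour v R
      (s≤s⁻¹ (≤-trans 2≤d (≤-trans (≤-reflexive (deg-↭ v σ)) (deg≤1+ v a R)))) =
    a , b , R′ , trans σ (prep a τ) , va , vb

  -- The `k` paths cover only 3k vertices, so two of the 3k + 2 neighbours of `v` escape them and
  -- carry one more path centred at `v`.
  Packing-centred : ∀ {k L v L′} → L ↭ v ∷ L′ → k * 3 + 2 ≤ deg v L′ → Packing k L′ → Packing (suc k) L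
  Packing-centred {k} {L} {v} {L′} σ large (X , R , τ , ps) = extend (two-neighbours v R 2≤d)
    where
    2≤d : 2 ≤ deg v R
    2≤d = +-cancelˡ-≤ (k * 3) _ _ (begin
      k * 3 + 2             ≤⟨ large ⟩
      deg v L′              ≡⟨ deg-↭ v τ ⟩
      deg v (X ++ R)        ≡⟨ deg-++ v X R ⟩
      deg v X + deg v R     ≤⟨ +-monoˡ-≤ _ (deg≤length v X) ⟩
      length X + deg v R    ≡⟨ cong (_+ deg v R) (length-Paths ps) ⟩
      k * 3 + deg v R       ∎)
      where open ≤-Reasoning

    extend : (∃₂ λ a b → ∃ λ R′ → R ↭ a ∷ b ∷ R′ × v ~ a × v ~ b) → Packing (suc k) L
    extend (a , b , R′ , ρ , va , vb) = Packing-suc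
      (reorder (1 ∷ 0 ∷ 2 ∷ []) (trans σ (prep v (trans τ (trans (++⁺ˡ X ρ) (shifts X (a ∷ b ∷ [])))))))
      (va ˘) vb (X , R′ , refl , ps)

  packing⊎matching : ∀ k L → Packing (suc k) L ⊎
    ∃₂ λ X R → L ↭ X ++ R × length X ≤ k * 3 × Paired R
  packing⊎matching k L with path⊎matching L
  ... | inj₂ (M , σ , m) = inj₂ ([] , M , σ , z≤n , m)
  packing⊎matching zero    L | inj₁ p = inj₁ (Path⇒Packing p)
  packing⊎matching (suc k) L | inj₁ (path {a} {b} {c} {R} σ ab bc) with packing⊎matching k R
  ... | inj₁ ps = inj₁ (Packing-suc σ ab bc ps)
  ... | inj₂ (X , M , τ , X≤ , m) =
    inj₂ (a ∷ b ∷ c ∷ X , M , trans σ (prep a (prep b (prep c τ))) , s≤s (s≤s (s≤s X≤)) , m)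

  large-degree? : ∀ D L → (∃₂ λ v L′ → L ↭ v ∷ L′ × D < deg v L′) ⊎ All (λ v → deg v L ≤ D) L
  large-degree? D L with any? (λ v → D <? deg v L) L
  ... | no ¬large = inj₂ (All.map ≮⇒≥ (¬Any⇒All¬ L ¬large))
  ... | yes large with v , v∈L , D<d ← find large with L′ , σ ← ∈-front v∈L =
    -- By irreflexivity `v` adds nothing to its own degree, so the degree into `L′` is the full one.
    inj₁ (v , L′ , σ , ≤-trans D<d (≤-reflexive (≡-trans (deg-↭ v σ) (cong (λ b → (if b then 1 else 0) + deg v L′) (irrefl G v)))))

  -- The vertices of `L` arranged as the join factor, H and the rest in F_{n,a+1}(H).
  record Structure (a : ℕ) {h : ℕ} (H : Graph (Fin h)) (L : List V) : Set where
    field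
      core       : List V
      core-size  : length core ≡ a
      block      : List (V × Fin h)
      block-size : length block ≡ h
      embeds     : AllPairs (Embeds G H) block
      rest       : List V
      separated  : All (λ b → All (proj₁ b ≁_) rest) block
      paired     : Paired rest
      arranged   : L ↭ core ++ map proj₁ block ++ rest

  -- The join factor is a clique joined to everything, hence it takes in `v` whatever its neighbours
  -- are.
  Structure-∷ : ∀ {a h} {H : Graph (Fin h)} {L v L′} → L ↭ v ∷ L′ → Structure a H L′ → Structure (suc a) H L
  Structure-∷ {v = v} σ S = record
    { core = v ∷ core ; core-size = cong suc core-size
    ; block = block ; block-size = block-size ; embeds = embeds
    ; rest = rest ; separated = separated ; paired = paired
    ; arranged = trans σ (prep v arranged) }
    where open Structure S

  -- With j = k - 2, the join factor of F_{n,k} has k - 1 = j + 1 vertices and that of F_{n,k-1}(H)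
  -- has j.
  data Exceptional (j : ℕ) (L : List V) : Set where
    clique₂ : Structure (suc j) (K 2) L → Exceptional j L
    clique₄ : Structure j (K 4) L → Exceptional j L
    clique₅ : Structure j (K 5) L → Exceptional j L
    net     : Structure j N₆ L → Exceptional j L

  Exceptional-∷ : ∀ {j L v L′} → L ↭ v ∷ L′ → Exceptional j L′ → Exceptional (suc j) L
  Exceptional-∷ σ (clique₂ S) = clique₂ (Structure-∷ σ S)
  Exceptional-∷ σ (clique₄ S) = clique₄ (Structure-∷ σ S)
  Exceptional-∷ σ (clique₅ S) = clique₅ (Structure-∷ σ S)
  Exceptional-∷ σ (net S)     = net (Structure-∷ σ S)

  label : (B : List V) → List (V × Fin (length B))
  label []      = []
  label (b ∷ B) = (b , zero) ∷ map (map₂ suc) (label B)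

  map-proj₁-map₂ : ∀ {A B : Set} (f : A → B) (ps : List (V × A)) → map proj₁ (map (map₂ f) ps) ≡ map proj₁ ps
  map-proj₁-map₂ f ps = sym (map-∘ ps)

  label-proj₁ : ∀ B → map proj₁ (label B) ≡ B
  label-proj₁ []      = refl
  label-proj₁ (b ∷ B) = cong (b ∷_) (≡-trans (map-proj₁-map₂ suc (label B)) (label-proj₁ B))

  label-length : ∀ B → length (label B) ≡ length B
  label-length []      = refl
  label-length (b ∷ B) = cong suc (≡-trans (length-map _ (label B)) (label-length B))

  label-embeds : ∀ B → AllPairs (Embeds G (K (length B))) (label B)
  label-embeds []      = []
  label-embeds (b ∷ B) =
    All-map⁺ (All.universal (λ _ → (λ ()) , const refl) (label B)) ∷
    AllPairs-map⁺ (AllPairs.map (λ (i≢j , _) → i≢j ∘ suc-injective , const (K-adjacent (i≢j ∘ suc-injective))) (label-embeds B))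

  Closed : List V → List V → Set
  Closed B R = All (λ b → All (b ≁_) R) B

  -- The join factor of F_{n,1}(H) is empty. Vertices that no edge leaves fit as a complete block,
  -- whatever edges they span.
  block-structure : ∀ {L R M} B → L ↭ B ++ R → Closed B R → R ↭ M → Paired M → Structure 0 (K (length B)) L
  block-structure {M = M} B σ closed ρ m = record
    { core = [] ; core-size = refl
    ; block = label B ; block-size = label-length B ; embeds = label-embeds B
    ; rest = M
    ; separated = All-map⁻ (subst (All (λ b → All (b ≁_) M)) (sym (label-proj₁ B)) (All.map (All-resp-↭ ρ) closed))
    ; paired = m
    ; arranged = trans σ (trans (++⁺ˡ B ρ) (↭-reflexive (cong (_++ M) (sym (label-proj₁ B)))))
    }

  -- The case k = 2

  Outcome : ℕ → List V → Set
  Outcome j L = Packing (2 + j) L ⊎ Exceptional j L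

  module _ {T : List V} (5≤T : 5 ≤ length T) where

    two-paths : ∀ {a b c S} → T ↭ a ∷ b ∷ c ∷ S → a ~ b → b ~ c → Path S → Outcome 0 T
    two-paths σ ab bc p = inj₁ (Packing-suc σ ab bc (Path⇒Packing p))

    disjoint : ∀ {a b c d f g R} → T ↭ a ∷ b ∷ c ∷ d ∷ f ∷ g ∷ R → a ~ b → b ~ c → d ~ f → f ~ g → Outcome 0 T
    disjoint σ ab bc df fg = two-paths σ ab bc (path refl df fg)

    -- Every P₃ passes through `v`, which becomes the join factor of F_{n,2}; the first two entries
    -- of the matching serve as its K₂ block.
    star : ∀ {v S} → T ↭ v ∷ S → Matching S → Outcome 0 T
    star {v} σ (M , τ , m) = go M (trans σ (prep v τ)) m
      where
      go : ∀ M → T ↭ v ∷ M → Paired M → Outcome 0 T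
      go (x ∷ y ∷ M) σ (pair x≁ y≁ m) = inj₂ (clique₂ (record
        { core = [ v ] ; core-size = refl
        ; block = label (x ∷ y ∷ []) ; block-size = refl ; embeds = label-embeds (x ∷ y ∷ [])
        ; rest = M ; separated = x≁ ∷ y≁ ∷ [] ; paired = m ; arranged = σ }))
      go []      σ _ with s≤s () ← subst (5 ≤_) (↭-length σ) 5≤T
      go (_ ∷ []) σ _ with s≤s (s≤s ()) ← subst (5 ≤_) (↭-length σ) 5≤T

    closed : ∀ {R} B → T ↭ B ++ R → Path B → (∀ {M} → R ↭ M → Paired M → Outcome 0 T) → Outcome 0 T
    closed {R} B σ (path {R = B′} τ ab bc) k with path⊎matching R
    ... | inj₁ p           = two-paths (trans σ (++⁺ʳ R τ)) ab bc (Path-++ʳ B′ p)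
    ... | inj₂ (M , ρ , m) = k ρ m

    -- Three vertices are fewer than a permitted block has. They are filled up to a K₅ by a whole
    -- pair of the remaining matching, so that no edge is cut.
    closed₃ : ∀ {a b c R} → T ↭ a ∷ b ∷ c ∷ R → a ~ b → b ~ c → Closed (a ∷ b ∷ c ∷ []) R → Outcome 0 T
    closed₃ {a} {b} {c} σ ab bc cl = closed (a ∷ b ∷ c ∷ []) σ (path refl ab bc) λ ρ → go (within 3 σ ρ) (All.map (All-resp-↭ ρ) cl)
      where
      go : ∀ {M} → T ↭ a ∷ b ∷ c ∷ M → Closed (a ∷ b ∷ c ∷ []) M → Paired M → Outcome 0 T
      go {x ∷ y ∷ M} σ ((_ ∷ _ ∷ a≁) ∷ (_ ∷ _ ∷ b≁) ∷ (_ ∷ _ ∷ c≁) ∷ []) (pair x≁ y≁ m) =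
        inj₂ (clique₅ (block-structure (a ∷ b ∷ c ∷ x ∷ y ∷ []) σ (a≁ ∷ b≁ ∷ c≁ ∷ x≁ ∷ y≁ ∷ []) refl m))
      go {[]}     σ _ _ with s≤s (s≤s (s≤s ())) ← subst (5 ≤_) (↭-length σ) 5≤T
      go {_ ∷ []} σ _ _ with s≤s (s≤s (s≤s (s≤s ()))) ← subst (5 ≤_) (↭-length σ) 5≤T

    closed₄ : ∀ {a b c d R} → T ↭ a ∷ b ∷ c ∷ d ∷ R → a ~ b → b ~ c → Closed (a ∷ b ∷ c ∷ d ∷ []) R → Outcome 0 T
    closed₄ {a} {b} {c} {d} σ ab bc cl = closed (a ∷ b ∷ c ∷ d ∷ []) σ (path refl ab bc)
      λ ρ m → inj₂ (clique₄ (block-structure (a ∷ b ∷ c ∷ d ∷ []) σ cl ρ m))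

    closed₅ : ∀ {a b c d f R} → T ↭ a ∷ b ∷ c ∷ d ∷ f ∷ R → a ~ b → b ~ c → Closed (a ∷ b ∷ c ∷ d ∷ f ∷ []) R → Outcome 0 T
    closed₅ {a} {b} {c} {d} {f} σ ab bc cl = closed (a ∷ b ∷ c ∷ d ∷ f ∷ []) σ (path refl ab bc)
      λ ρ m → inj₂ (clique₅ (block-structure (a ∷ b ∷ c ∷ d ∷ f ∷ []) σ cl ρ m))

    -- A P₃ avoiding `v` leaves two of five neighbours free for a path centred at `v`; if there is
    -- none, `v` meets every P₃.
    degree≥5 : ∀ {v a b c d f R} → T ↭ v ∷ a ∷ b ∷ c ∷ d ∷ f ∷ R → v ~ a → v ~ b → v ~ c → v ~ d → v ~ f → Outcome 0 T
    degree≥5 {v} {a} {b} {c} {d} {f} {R} σ va vb vc vd vf with path⊎matching (a ∷ b ∷ c ∷ d ∷ f ∷ R)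
    ... | inj₂ m = star σ m
    ... | inj₁ p = inj₁ (Packing-centred σ 5≤d (Path⇒Packing p))
      where
      5≤d : 5 ≤ deg v (a ∷ b ∷ c ∷ d ∷ f ∷ R)
      5≤d rewrite va | vb | vc | vd | vf = m≤m+n 5 (deg v R)

    -- A further edge at `p` or `q` uses up at most one of b, c, d, and the other two carry a path
    -- through `v`. So the edge p q is a component of T - v, and the path v p q is disjoint from any
    -- path beyond it.
    degree≥4-edge : ∀ {v p q b c d R} → T ↭ v ∷ p ∷ q ∷ b ∷ c ∷ d ∷ R →
      v ~ p → p ~ q → v ~ b → v ~ c → v ~ d → Outcome 0 T
    degree≥4-edge {v} {p} {q} {b} {c} {d} {R} σ vp pq vb vc vd
      with isolated σ pq | isolated (reorder (0 ∷ 2 ∷ 1 ∷ []) σ) (pq ˘) | path⊎matching (b ∷ c ∷ d ∷ R)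
      where
      isolated : ∀ {p q} → T ↭ v ∷ p ∷ q ∷ b ∷ c ∷ d ∷ R → p ~ q → Outcome 0 T ⊎ All (p ≁_) (b ∷ c ∷ d ∷ R)
      isolated {p} σ pq with adjacent? p b | adjacent? p c | adjacent? p d | neighbour? p R
      ... | inj₁ pb | _ | _ | _ = inj₁ (disjoint (reorder (2 ∷ 1 ∷ 3 ∷ 4 ∷ 0 ∷ 5 ∷ []) σ) (pq ˘) pb (vc ˘) vd)
      ... | _ | inj₁ pc | _ | _ = inj₁ (disjoint (reorder (2 ∷ 1 ∷ 4 ∷ 3 ∷ 0 ∷ 5 ∷ []) σ) (pq ˘) pc (vb ˘) vd)
      ... | _ | _ | inj₁ pd | _ = inj₁ (disjoint (reorder (2 ∷ 1 ∷ 5 ∷ 3 ∷ 0 ∷ 4 ∷ []) σ) (pq ˘) pd (vb ˘) vc)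
      ... | _ | _ | _ | inj₁ (_ , _ , ρ , pz) =
        inj₁ (disjoint (reorder (2 ∷ 1 ∷ 6 ∷ 3 ∷ 0 ∷ 4 ∷ []) (within 6 σ ρ)) (pq ˘) pz (vb ˘) vc)
      ... | inj₂ pb | inj₂ pc | inj₂ pd | inj₂ pR = inj₂ (pb ∷ pc ∷ pd ∷ pR)
    ... | inj₁ o  | _       | _      = o
    ... | _       | inj₁ o  | _      = o
    ... | _       | _       | inj₁ π = two-paths (reorder (0 ∷ 1 ∷ 2 ∷ []) σ) vp pq π
    ... | inj₂ p≁ | inj₂ q≁ | inj₂ m = star σ (Matching-pair p≁ q≁ m)

    degree≥4 : ∀ {v a b c d R} → T ↭ v ∷ a ∷ b ∷ c ∷ d ∷ R → v ~ a → v ~ b → v ~ c → v ~ d → Outcome 0 T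
    degree≥4 {v} {a} {b} {c} {d} {R} σ va vb vc vd
      with neighbour? v R | neighbour? a R | neighbour? b R | neighbour? c R | neighbour? d R
    ... | inj₁ (_ , _ , ρ , vz) | _ | _ | _ | _ = degree≥5 (within 5 σ ρ) va vb vc vd vz
    ... | _ | inj₁ (_ , _ , ρ , az) | _ | _ | _ = degree≥4-edge (reorder (0 ∷ 1 ∷ 5 ∷ []) (within 5 σ ρ)) va az vb vc vd
    ... | _ | _ | inj₁ (_ , _ , ρ , bz) | _ | _ = degree≥4-edge (reorder (0 ∷ 2 ∷ 5 ∷ []) (within 5 σ ρ)) vb bz va vc vd
    ... | _ | _ | _ | inj₁ (_ , _ , ρ , cz) | _ = degree≥4-edge (reorder (0 ∷ 3 ∷ 5 ∷ []) (within 5 σ ρ)) vc cz va vb vd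
    ... | _ | _ | _ | _ | inj₁ (_ , _ , ρ , dz) = degree≥4-edge (reorder (0 ∷ 4 ∷ 5 ∷ []) (within 5 σ ρ)) vd dz va vb vc
    ... | inj₂ v≁ | inj₂ a≁ | inj₂ b≁ | inj₂ c≁ | inj₂ d≁ =
      closed₅ (reorder (1 ∷ 0 ∷ []) σ) (va ˘) vb (a≁ ∷ v≁ ∷ b≁ ∷ c≁ ∷ d≁ ∷ [])

    -- Any additional edge at a net creates two disjoint P₃'s. By rotation it is enough to test the
    -- edges at `t₀` and `p₀`; the order of the block is that of the numbering of `N₆`.
    triangle-with-pendants : ∀ {t₀ t₁ t₂ p₀ p₁ p₂ R} → T ↭ t₀ ∷ t₁ ∷ t₂ ∷ p₀ ∷ p₁ ∷ p₂ ∷ R →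
      t₀ ~ t₁ → t₁ ~ t₂ → t₂ ~ t₀ → t₀ ~ p₀ → t₁ ~ p₁ → t₂ ~ p₂ → Outcome 0 T
    triangle-with-pendants {t₀} {t₁} {t₂} {p₀} {p₁} {p₂} {R} σ t₀₁ t₁₂ t₂₀ tp₀ tp₁ tp₂
      with induced σ t₀₁ t₁₂ t₂₀ tp₀ tp₁ tp₂
         | induced (reorder (1 ∷ 2 ∷ 0 ∷ 4 ∷ 5 ∷ 3 ∷ []) σ) t₁₂ t₂₀ t₀₁ tp₁ tp₂ tp₀
         | induced (reorder (2 ∷ 0 ∷ 1 ∷ 5 ∷ 3 ∷ 4 ∷ []) σ) t₂₀ t₀₁ t₁₂ tp₂ tp₀ tp₁
      where
      induced : ∀ {t₀ t₁ t₂ p₀ p₁ p₂} → T ↭ t₀ ∷ t₁ ∷ t₂ ∷ p₀ ∷ p₁ ∷ p₂ ∷ R →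
        t₀ ~ t₁ → t₁ ~ t₂ → t₂ ~ t₀ → t₀ ~ p₀ → t₁ ~ p₁ → t₂ ~ p₂ →
        Outcome 0 T ⊎ (p₀ ≁ p₁ × p₀ ≁ t₁ × p₀ ≁ t₂ × All (p₀ ≁_) R × All (t₀ ≁_) R)
      induced {t₀} {t₁} {t₂} {p₀} {p₁} σ t₀₁ t₁₂ t₂₀ tp₀ tp₁ tp₂
        with adjacent? p₀ p₁ | adjacent? p₀ t₁ | adjacent? p₀ t₂ | neighbour? p₀ R | neighbour? t₀ R
      ... | inj₁ pp | _ | _ | _ | _ = inj₁ (disjoint (reorder (3 ∷ 4 ∷ 1 ∷ 0 ∷ 2 ∷ 5 ∷ []) σ) pp (tp₁ ˘) (t₂₀ ˘) tp₂)
      ... | _ | inj₁ pt | _ | _ | _ = inj₁ (disjoint (reorder (3 ∷ 1 ∷ 4 ∷ 0 ∷ 2 ∷ 5 ∷ []) σ) pt tp₁ (t₂₀ ˘) tp₂)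
      ... | _ | _ | inj₁ pt | _ | _ = inj₁ (disjoint (reorder (3 ∷ 2 ∷ 5 ∷ 0 ∷ 1 ∷ 4 ∷ []) σ) pt tp₂ t₀₁ tp₁)
      ... | _ | _ | _ | inj₁ (_ , _ , ρ , pz) | _ =
        inj₁ (disjoint (reorder (6 ∷ 3 ∷ 0 ∷ 1 ∷ 2 ∷ 5 ∷ []) (within 6 σ ρ)) (pz ˘) (tp₀ ˘) t₁₂ tp₂)
      ... | _ | _ | _ | _ | inj₁ (_ , _ , ρ , tz) =
        inj₁ (disjoint (reorder (6 ∷ 0 ∷ 3 ∷ 1 ∷ 2 ∷ 5 ∷ []) (within 6 σ ρ)) (tz ˘) tp₀ t₁₂ tp₂)
      ... | inj₂ pp | inj₂ pt₁ | inj₂ pt₂ | inj₂ p≁ | inj₂ t≁ = inj₂ (pp , pt₁ , pt₂ , p≁ , t≁)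
    ... | inj₁ o | _ | _ = o
    ... | _ | inj₁ o | _ = o
    ... | _ | _ | inj₁ o = o
    ... | inj₂ (p₀₁ , pt₀₁ , pt₀₂ , p₀≁ , t₀≁) | inj₂ (p₁₂ , pt₁₂ , pt₁₀ , p₁≁ , t₁≁) | inj₂ (p₂₀ , pt₂₀ , pt₂₁ , p₂≁ , t₂≁) =
      closed (t₀ ∷ t₁ ∷ t₂ ∷ p₀ ∷ p₁ ∷ p₂ ∷ []) σ (path refl t₀₁ t₁₂) λ ρ m → inj₂ (net (record
        { core = [] ; core-size = refl
        ; block = label (t₀ ∷ t₁ ∷ t₂ ∷ p₀ ∷ p₁ ∷ p₂ ∷ []) ; block-size = refl
        ; embeds =
            (((λ ()) , const refl) ∷ ((λ ()) , const refl) ∷ ((λ ()) , const refl) ∷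
             ((λ ()) , ≁⇒¬~ (pt₁₀ ˘)) ∷ ((λ ()) , ≁⇒¬~ (pt₂₀ ˘)) ∷ []) ∷
            (((λ ()) , const refl) ∷ ((λ ()) , ≁⇒¬~ (pt₀₁ ˘)) ∷ ((λ ()) , const refl) ∷
             ((λ ()) , ≁⇒¬~ (pt₂₁ ˘)) ∷ []) ∷
            (((λ ()) , ≁⇒¬~ (pt₀₂ ˘)) ∷ ((λ ()) , ≁⇒¬~ (pt₁₂ ˘)) ∷ ((λ ()) , const refl) ∷ []) ∷
            (((λ ()) , ≁⇒¬~ p₀₁) ∷ ((λ ()) , ≁⇒¬~ (p₂₀ ˘)) ∷ []) ∷
            (((λ ()) , ≁⇒¬~ p₁₂) ∷ []) ∷ [] ∷ []
        ; rest = _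
        ; separated = All.map (All-resp-↭ ρ) (t₀≁ ∷ t₁≁ ∷ t₂≁ ∷ p₀≁ ∷ p₁≁ ∷ p₂≁ ∷ [])
        ; paired = m
        ; arranged = within 6 σ ρ }))

    degree≥3-square : ∀ {v a x b c R} → T ↭ v ∷ a ∷ x ∷ b ∷ c ∷ R →
      v ~ a → a ~ x → x ~ b → v ~ b → v ~ c → Closed (v ∷ a ∷ x ∷ []) R → Outcome 0 T
    degree≥3-square {b = b} {c} {R} σ va ax xb vb vc (v≁ ∷ a≁ ∷ x≁ ∷ []) with neighbour? b R | neighbour? c R
    ... | inj₁ (_ , _ , ρ , by) | _ = disjoint (reorder (5 ∷ 3 ∷ 2 ∷ 1 ∷ 0 ∷ 4 ∷ []) (within 5 σ ρ)) (by ˘) (xb ˘) (va ˘) vc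
    ... | _ | inj₁ (_ , _ , ρ , cy) = disjoint (reorder (5 ∷ 4 ∷ 0 ∷ 1 ∷ 2 ∷ 3 ∷ []) (within 5 σ ρ)) (cy ˘) (vc ˘) ax xb
    ... | inj₂ b≁ | inj₂ c≁ = closed₅ σ va ax (v≁ ∷ a≁ ∷ x≁ ∷ b≁ ∷ c≁ ∷ [])

    -- This is the source of the net: the triangle v a b already has the pendants c and x, and an
    -- edge leaving b supplies the third.
    degree≥3-triangle : ∀ {v a x b c R} → T ↭ v ∷ a ∷ x ∷ b ∷ c ∷ R →
      v ~ a → a ~ x → a ~ b → v ~ b → v ~ c → Closed (v ∷ a ∷ x ∷ []) R → Outcome 0 T
    degree≥3-triangle {b = b} {c} {R} σ va ax ab vb vc (v≁ ∷ a≁ ∷ x≁ ∷ []) with neighbour? b R | neighbour? c R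
    ... | inj₁ (_ , _ , ρ , by) | _ =
      triangle-with-pendants (reorder (0 ∷ 1 ∷ 3 ∷ 4 ∷ 2 ∷ 5 ∷ []) (within 5 σ ρ)) va ab (vb ˘) vc ax by
    ... | _ | inj₁ (_ , _ , ρ , cy) = disjoint (reorder (5 ∷ 4 ∷ 0 ∷ 2 ∷ 1 ∷ 3 ∷ []) (within 5 σ ρ)) (cy ˘) (vc ˘) (ax ˘) ab
    ... | inj₂ b≁ | inj₂ c≁ = closed₅ σ va ax (v≁ ∷ a≁ ∷ x≁ ∷ b≁ ∷ c≁ ∷ [])

    -- The path b v c in reserve forbids edges from `a` or `x` to the outside. An edge between a, x
    -- and b, c closes a square or a triangle; without one, a x is a component of T - v.
    degree≥3-edge : ∀ {v a x b c R} → T ↭ v ∷ a ∷ x ∷ b ∷ c ∷ R →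
      v ~ a → a ~ x → v ~ b → v ~ c → Outcome 0 T
    degree≥3-edge {v} {a} {x} {b} {c} {R} σ va ax vb vc with neighbour? v R | neighbour? a R | neighbour? x R
    ... | inj₁ (_ , _ , ρ , vz) | _ | _ = degree≥4 (reorder (0 ∷ 1 ∷ 3 ∷ 4 ∷ 5 ∷ []) (within 5 σ ρ)) va vb vc vz
    ... | _ | inj₁ (_ , _ , ρ , az) | _ = disjoint (reorder (2 ∷ 1 ∷ 5 ∷ 3 ∷ 0 ∷ 4 ∷ []) (within 5 σ ρ)) (ax ˘) az (vb ˘) vc
    ... | _ | _ | inj₁ (_ , _ , ρ , xz) = disjoint (reorder (1 ∷ 2 ∷ 5 ∷ 3 ∷ 0 ∷ 4 ∷ []) (within 5 σ ρ)) ax xz (vb ˘) vc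
    ... | inj₂ v≁ | inj₂ a≁ | inj₂ x≁
      with adjacent? x b | adjacent? x c | adjacent? a b | adjacent? a c | path⊎matching (b ∷ c ∷ R)
    ... | inj₁ xb | _ | _ | _ | _ = degree≥3-square σ va ax xb vb vc (v≁ ∷ a≁ ∷ x≁ ∷ [])
    ... | _ | inj₁ xc | _ | _ | _ = degree≥3-square (reorder (0 ∷ 1 ∷ 2 ∷ 4 ∷ []) σ) va ax xc vc vb (v≁ ∷ a≁ ∷ x≁ ∷ [])
    ... | _ | _ | inj₁ ab | _ | _ = degree≥3-triangle σ va ax ab vb vc (v≁ ∷ a≁ ∷ x≁ ∷ [])
    ... | _ | _ | _ | inj₁ ac | _ = degree≥3-triangle (reorder (0 ∷ 1 ∷ 2 ∷ 4 ∷ []) σ) va ax ac vc vb (v≁ ∷ a≁ ∷ x≁ ∷ [])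
    ... | _ | _ | _ | _ | inj₁ p = two-paths σ va ax p
    ... | inj₂ x≁b | inj₂ x≁c | inj₂ a≁b | inj₂ a≁c | inj₂ m =
      star σ (Matching-pair (a≁b ∷ a≁c ∷ a≁) (x≁b ∷ x≁c ∷ x≁) m)

    degree≥3 : ∀ {v a b c R} → T ↭ v ∷ a ∷ b ∷ c ∷ R → v ~ a → v ~ b → v ~ c → Outcome 0 T
    degree≥3 {v} {a} {b} {c} {R} σ va vb vc with neighbour? v R | neighbour? a R | neighbour? b R | neighbour? c R
    ... | inj₁ (_ , _ , ρ , vz) | _ | _ | _ = degree≥4 (within 4 σ ρ) va vb vc vz
    ... | _ | inj₁ (_ , _ , ρ , az) | _ | _ = degree≥3-edge (reorder (0 ∷ 1 ∷ 4 ∷ []) (within 4 σ ρ)) va az vb vc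
    ... | _ | _ | inj₁ (_ , _ , ρ , bz) | _ = degree≥3-edge (reorder (0 ∷ 2 ∷ 4 ∷ []) (within 4 σ ρ)) vb bz va vc
    ... | _ | _ | _ | inj₁ (_ , _ , ρ , cz) = degree≥3-edge (reorder (0 ∷ 3 ∷ 4 ∷ []) (within 4 σ ρ)) vc cz va vb
    ... | inj₂ v≁ | inj₂ a≁ | inj₂ b≁ | inj₂ c≁ =
      closed₄ (reorder (1 ∷ 0 ∷ []) σ) (va ˘) vb (a≁ ∷ v≁ ∷ b≁ ∷ c≁ ∷ [])

    -- Growth of a path ends here: a sixth vertex splits it into two P₃'s, and an outside edge at an
    -- inner vertex gives degree three.
    path-on-5 : ∀ {a b c d f R} → T ↭ a ∷ b ∷ c ∷ d ∷ f ∷ R → a ~ b → b ~ c → c ~ d → d ~ f → Outcome 0 T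
    path-on-5 {a} {b} {c} {d} {f} {R} σ ab bc cd df
      with neighbour? a R | neighbour? b R | neighbour? c R | neighbour? d R | neighbour? f R
    ... | inj₁ (_ , _ , ρ , az) | _ | _ | _ | _ = disjoint (reorder (5 ∷ 0 ∷ 1 ∷ 2 ∷ 3 ∷ 4 ∷ []) (within 5 σ ρ)) (az ˘) ab cd df
    ... | _ | inj₁ (_ , _ , ρ , bz) | _ | _ | _ = degree≥3 (reorder (1 ∷ 0 ∷ 2 ∷ 5 ∷ []) (within 5 σ ρ)) (ab ˘) bc bz
    ... | _ | _ | inj₁ (_ , _ , ρ , cz) | _ | _ = degree≥3 (reorder (2 ∷ 1 ∷ 3 ∷ 5 ∷ []) (within 5 σ ρ)) (bc ˘) cd cz
    ... | _ | _ | _ | inj₁ (_ , _ , ρ , dz) | _ = degree≥3 (reorder (3 ∷ 2 ∷ 4 ∷ 5 ∷ []) (within 5 σ ρ)) (cd ˘) df dz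
    ... | _ | _ | _ | _ | inj₁ (_ , _ , ρ , fz) = disjoint (within 5 σ ρ) ab bc df fz
    ... | inj₂ a≁ | inj₂ b≁ | inj₂ c≁ | inj₂ d≁ | inj₂ f≁ = closed₅ σ ab bc (a≁ ∷ b≁ ∷ c≁ ∷ d≁ ∷ f≁ ∷ [])

    path-on-4 : ∀ {a b c d R} → T ↭ a ∷ b ∷ c ∷ d ∷ R → a ~ b → b ~ c → c ~ d → Outcome 0 T
    path-on-4 {a} {b} {c} {d} {R} σ ab bc cd with neighbour? a R | neighbour? b R | neighbour? c R | neighbour? d R
    ... | inj₁ (_ , _ , ρ , az) | _ | _ | _ = path-on-5 (reorder (4 ∷ []) (within 4 σ ρ)) (az ˘) ab bc cd
    ... | _ | inj₁ (_ , _ , ρ , bz) | _ | _ = degree≥3 (reorder (1 ∷ 0 ∷ 2 ∷ 4 ∷ []) (within 4 σ ρ)) (ab ˘) bc bz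
    ... | _ | _ | inj₁ (_ , _ , ρ , cz) | _ = degree≥3 (reorder (2 ∷ 1 ∷ 3 ∷ 4 ∷ []) (within 4 σ ρ)) (bc ˘) cd cz
    ... | _ | _ | _ | inj₁ (_ , _ , ρ , dz) = path-on-5 (within 4 σ ρ) ab bc cd dz
    ... | inj₂ a≁ | inj₂ b≁ | inj₂ c≁ | inj₂ d≁ = closed₄ σ ab bc (a≁ ∷ b≁ ∷ c≁ ∷ d≁ ∷ [])

    path-on-3 : ∀ {a b c R} → T ↭ a ∷ b ∷ c ∷ R → a ~ b → b ~ c → Outcome 0 T
    path-on-3 {a} {b} {c} {R} σ ab bc with neighbour? a R | neighbour? b R | neighbour? c R
    ... | inj₁ (_ , _ , ρ , az) | _ | _ = path-on-4 (reorder (3 ∷ []) (within 3 σ ρ)) (az ˘) ab bc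
    ... | _ | inj₁ (_ , _ , ρ , bz) | _ = degree≥3 (reorder (1 ∷ 0 ∷ 2 ∷ 3 ∷ []) (within 3 σ ρ)) (ab ˘) bc bz
    ... | _ | _ | inj₁ (_ , _ , ρ , cz) = path-on-4 (within 3 σ ρ) ab bc cz
    ... | inj₂ a≁ | inj₂ b≁ | inj₂ c≁ = closed₃ σ ab bc (a≁ ∷ b≁ ∷ c≁ ∷ [])

  -- Setting an arbitrary `v` aside before the search also settles the case without any P₃: `v` then
  -- acts as the centre.
  outcome-2 : ∀ L → 5 ≤ length L → Outcome 0 L
  outcome-2 (v ∷ S) 5≤L with path⊎matching S
  ... | inj₁ p with path σ ab bc ← Path-++ʳ [ v ] p = path-on-3 5≤L σ ab bc
  ... | inj₂ m = star 5≤L refl m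

  -- The induction on k = j + 2

  few-edges : ∀ D X R {L} → L ↭ X ++ R → All (λ v → deg v L ≤ D) L → Paired R →
    2 * edges L ≤ 2 * (length X * D) + length L
  few-edges D X R {L} σ small m = begin
    2 * edges L                         ≡⟨ cong (2 *_) (edges-↭ σ) ⟩
    2 * edges (X ++ R)                  ≤⟨ *-monoʳ-≤ 2 (edges-++ D X R small-X) ⟩
    2 * (length X * D + edges R)        ≡⟨ *-distribˡ-+ 2 (length X * D) (edges R) ⟩
    2 * (length X * D) + 2 * edges R    ≤⟨ +-monoʳ-≤ (2 * (length X * D)) (≤-trans (edges-Paired m) R≤L) ⟩
    2 * (length X * D) + length L       ∎
    where
    open ≤-Reasoning
    small-X : All (λ x → deg x (X ++ R) ≤ D) X
    small-X = All-++⁻ˡ X (All-resp-↭ σ (All.map (λ {v} → subst (_≤ D) (deg-↭ v σ)) small))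
    R≤L : length R ≤ length L
    R≤L = ≤-trans (m≤n+m (length R) (length X)) (≤-reflexive (sym (≡-trans (↭-length σ) (length-++ X))))

  outcome : ∀ j L → 24 + 18 * j ≤ length L → (1 + 2 * j) * length L < 2 * edges L → Outcome j L
  outcome zero    L 24≤L _ = outcome-2 L (≤-trans (m≤m+n 5 19) 24≤L)
  outcome (suc j) L N≤L many = [ large-case , small-case ]′ (large-degree? D L)
    where
    D : ℕ
    -- For k = j + 3, a degree above D is at least 3(k - 1) + 2, which is what `Packing-centred`
    -- needs to extend k - 1 paths.
    D = (2 + j) * 3 + 1

    large-case : (∃₂ λ v L′ → L ↭ v ∷ L′ × D < deg v L′) → Outcome (suc j) L
    large-case (v , L′ , σ , D<d) = [ inj₁ ∘ Packing-centred σ (subst (_≤ deg v L′) (sym (+-suc ((2 + j) * 3) 1)) D<d) , inj₂ ∘ Exceptional-∷ σ ]′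
      (outcome j L′
        (size-step j _ (subst (24 + 18 * suc j ≤_) (↭-length σ) N≤L))
        (edge-step j _ _ _ (deg≤length v L′) (subst₂ (λ l q → (1 + 2 * suc j) * l < 2 * q) (↭-length σ) (edges-↭ σ) many)))

    small-case : All (λ v → deg v L ≤ D) L → Outcome (suc j) L
    small-case small = [ inj₁ , too-few ]′ (packing⊎matching (2 + j) L)
      where
      too-few : (∃₂ λ X R → L ↭ X ++ R × length X ≤ (2 + j) * 3 × Paired R) → Outcome (suc j) L
      too-few (X , R , σ , X≤ , m) = contradiction many (≤⇒≯ (begin
        2 * edges L                           ≤⟨ few-edges D X R σ small m ⟩
        2 * (length X * D) + length L         ≤⟨ +-monoˡ-≤ (length L) (*-monoʳ-≤ 2 (*-monoˡ-≤ D X≤)) ⟩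
        2 * ((2 + j) * 3 * D) + length L      ≤⟨ edge-bound j (length L) N≤L ⟩
        (1 + 2 * suc j) * length L            ∎))
        where open ≤-Reasoning

-- Embeddings into F and of k·P₃

module _ {V W : Set} (G : Graph V) (H : Graph W) where

  private
    compare : ∀ {ps p q} → AllPairs (Embeds G H) ps → p ∈ ps → q ∈ ps → p ≡ q ⊎ Embeds G H p q ⊎ Embeds G H q p
    compare _         (here refl)  (here refl)  = inj₁ refl
    compare (p∷ ∷ _)  (here refl)  (there q∈) = inj₂ (inj₁ (All.lookup p∷ q∈))
    compare (q∷ ∷ _)  (there p∈) (here refl)  = inj₂ (inj₂ (All.lookup q∷ p∈))
    compare (_ ∷ ps)  (there p∈) (there q∈) = compare ps p∈ q∈

  embedding : (ps : List (V × W)) → AllPairs (Embeds G H) ps → (∀ v → v ∈ map proj₁ ps) → G ⊆ᴳ H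
  embedding ps emb covers = f , f-injective , f-adj
    where
    image : ∀ v → ∃ λ p → p ∈ ps × v ≡ proj₁ p
    image v = ∈-map⁻ proj₁ (covers v)

    f : V → W
    f v = proj₂ (proj₁ (image v))

    f-injective : ∀ {u v} → f u ≡ f v → u ≡ v
    f-injective {u} {v} eq with image u | image v
    ... | p , p∈ , refl | q , q∈ , refl with compare emb p∈ q∈
    ...   | inj₁ refl             = refl
    ...   | inj₂ (inj₁ (p≢q , _)) = contradiction eq p≢q
    ...   | inj₂ (inj₂ (q≢p , _)) = contradiction (sym eq) q≢p

    f-adj : ∀ u v → adj G u v ≡ true → adj H (f u) (f v) ≡ true
    f-adj u v uv with image u | image v
    ... | p , p∈ , refl | q , q∈ , refl with compare emb p∈ q∈
    ...   | inj₁ refl              = ≁⇒¬~ G (irrefl G u) uv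
    ...   | inj₂ (inj₁ (_ , pres)) = pres uv
    ...   | inj₂ (inj₂ (_ , pres)) = _˘ H (pres (_˘ G uv))

module _ {V : Set} (G : Graph V) where

  private
    next : ∀ {p s} → (Fin p × Fin 2) ⊎ Fin s → (Fin (suc p) × Fin 2) ⊎ Fin s
    next (inj₁ (i , t)) = inj₁ (suc i , t)
    next (inj₂ z)       = inj₂ z

    next-injective : ∀ {p s} {x y : (Fin p × Fin 2) ⊎ Fin s} → next x ≡ next y → x ≡ y
    next-injective {x = inj₁ _} {inj₁ _} refl = refl
    next-injective {x = inj₂ _} {inj₂ _} refl = refl

    next-adj : ∀ {p s} (x y : (Fin p × Fin 2) ⊎ Fin s) →
      adj ((p ·ᴳ K 2) ∪ᴳ K s) x y ≡ true → adj ((suc p ·ᴳ K 2) ∪ᴳ K s) (next x) (next y) ≡ true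
    next-adj (inj₁ (i , t)) (inj₁ (j , u)) eq with i ≟ j
    ... | yes _ = eq
    next-adj (inj₂ x) (inj₂ y) eq = eq

    slot-≢ : ∀ {p s t} (x : (Fin p × Fin 2) ⊎ Fin s) → inj₁ (zero , t) ≢ next x
    slot-≢ (inj₁ _) ()
    slot-≢ (inj₂ _) ()

  -- Each pair fills one copy of K₂. A single last vertex takes half a copy or, when none is left,
  -- the vertex of K_s; `s < 2` rules out a pair without a copy.
  Paired-embeds : ∀ {M} p s → s < 2 → length M ≤ s + p * 2 → Paired G M →
    ∃ λ ps → map proj₁ ps ≡ M × AllPairs (Embeds G ((p ·ᴳ K 2) ∪ᴳ K s)) ps
  Paired-embeds p       s       _ _ []      = [] , refl , []
  Paired-embeds (suc p) s       _ _ ([-] {x}) = [ (x , inj₁ (zero , zero)) ] , refl , [] ∷ []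
  Paired-embeds zero    (suc s) _ _ ([-] {x}) = [ (x , inj₂ zero) ] , refl , [] ∷ []
  Paired-embeds zero    s s<2 M≤ (pair _ _ _) =
    contradiction (≤-trans (s≤s (s≤s z≤n)) (≤-trans M≤ (≤-reflexive (+-identityʳ s)))) (<⇒≱ s<2)
  Paired-embeds (suc p) s s<2 M≤ (pair {x} {y} {M} x≁ y≁ m)
    with ps , refl , emb ← Paired-embeds p s s<2
           (s≤s⁻¹ (s≤s⁻¹ (≤-trans M≤ (≤-reflexive (≡-trans (+-suc s _) (cong suc (+-suc s _))))))) m =
    (x , inj₁ (zero , zero)) ∷ (y , inj₁ (zero , suc zero)) ∷ map (map₂ next) ps ,
    cong (λ M → x ∷ y ∷ M) (map-proj₁-map₂ G next ps) ,
    (((λ ()) , const refl) ∷ first x≁) ∷ first y≁ ∷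
    AllPairs-map⁺ (AllPairs.map (λ {(_ , z)} {(_ , z′)} (z≢z′ , pres) → z≢z′ ∘ next-injective , next-adj z z′ ∘ pres) emb)
    where
    first : ∀ {w t ps} → All (_≁_ G w) (map proj₁ ps) →
      All (Embeds G ((suc p ·ᴳ K 2) ∪ᴳ K s) (w , inj₁ (zero , t))) (map (map₂ next) ps)
    first {ps = ps} w≁ = All-map⁺ (All.map (λ {(_ , z)} w≁u → slot-≢ z , ≁⇒¬~ G w≁u) (All-map⁻ {xs = ps} w≁))

  Structure⇒⊆F : ∀ {n a h} {H : Graph (Fin h)} {L} → length L ≡ n → (∀ v → v ∈ L) →
    Structure G a H L → G ⊆ᴳ F n (suc a) H
  Structure⇒⊆F {n} {a} {h} {H} {L} L≡n covers record
    { core = core ; core-size = refl ; block = block ; block-size = block-size ; embeds = embeds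
    ; rest = rest ; separated = separated ; paired = paired ; arranged = arranged } =
    go (Paired-embeds p s (m%n<n x 2) rest≤ paired)
    where
    x p s : ℕ
    -- This is the difference in `Fp` and `Fs` at `suc a`, since `suc a + h ∸ 1` reduces to `a + h`.
    x = n ∸ (a + h)
    p = x / 2
    s = x % 2

    size : n ≡ a + h + length rest
    size = begin
      n                                                    ≡⟨ L≡n ⟨
      length L                                             ≡⟨ ↭-length arranged ⟩
      length (core ++ map proj₁ block ++ rest)             ≡⟨ length-++ core ⟩
      length core + length (map proj₁ block ++ rest)       ≡⟨ cong (length core +_) (length-++ (map proj₁ block)) ⟩
      length core + (length (map proj₁ block) + length rest) ≡⟨ cong (λ b → length core + (b + length rest)) (≡-trans (length-map proj₁ block) block-size) ⟩
      a + (h + length rest)                                ≡⟨ +-assoc a h _ ⟨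
      a + h + length rest                                  ∎
      where open ≡-Reasoning

    rest≤ : length rest ≤ s + p * 2
    rest≤ = ≤-reflexive (≡-trans (sym (≡-trans (cong (_∸ (a + h)) size) (m+n∸m≡n (a + h) _))) (m≡m%n+[m/n]*n x 2))

    go : (∃ λ ps → map proj₁ ps ≡ rest × AllPairs (Embeds G ((p ·ᴳ K 2) ∪ᴳ K s)) ps) →
      G ⊆ᴳ F n (suc a) H
    go (ps , ps≡ , emb) = embedding G (F n (suc a) H) all-ps
      (AllPairs-++⁺
        (AllPairs-map⁺ (AllPairs.map (λ (i≢j , pres) → i≢j ∘ inj₁-injective , pres) (label-embeds G core)))
        (AllPairs-++⁺
          (AllPairs-map⁺ (AllPairs.map (λ (i≢j , pres) → i≢j ∘ inj₁-injective ∘ inj₂-injective , pres) embeds))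
          (AllPairs-map⁺ (AllPairs.map (λ (i≢j , pres) → i≢j ∘ inj₂-injective ∘ inj₂-injective , pres) emb))
          -- Block against rest are the only cross pairs nonadjacent in F, hence the only ones that
          -- call on `separated`.
          (All-map⁺ (All.map (λ b≁ → All-map⁺ (All.map (λ b≁u → (λ ()) , ≁⇒¬~ G b≁u)
            (All-map⁻ (subst (All _) (sym ps≡) b≁)))) separated)))
        (All-map⁺ (All.universal (λ _ → All-++⁺
          (All-map⁺ (All.universal (λ _ → (λ ()) , const refl) block))
          (All-map⁺ (All.universal (λ _ → (λ ()) , const refl) ps))) (label G core))))
      λ v → subst (v ∈_) (sym all-ps-proj₁) (∈-resp-↭ arranged (covers v))
      where
      Vertex : Set
      Vertex = Fin (length core) ⊎ (Fin h ⊎ ((Fin p × Fin 2) ⊎ Fin s))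

      all-ps : List (V × Vertex)
      all-ps = map (map₂ inj₁) (label G core) ++ map (map₂ (inj₂ ∘ inj₁)) block ++ map (map₂ (inj₂ ∘ inj₂)) ps

      all-ps-proj₁ : map proj₁ all-ps ≡ core ++ map proj₁ block ++ rest
      all-ps-proj₁ =
        ≡-trans (map-++ proj₁ (map (map₂ inj₁) (label G core)) _) (cong₂ _++_
          (≡-trans (map-proj₁-map₂ G inj₁ (label G core)) (label-proj₁ G core))
          (≡-trans (map-++ proj₁ (map (map₂ (inj₂ ∘ inj₁)) block) _) (cong₂ _++_
            (map-proj₁-map₂ G (inj₂ ∘ inj₁) block)
            (≡-trans (map-proj₁-map₂ G (inj₂ ∘ inj₂) ps) ps≡))))

  -- Copies of k·P₃ from packings

  vertex : ∀ {k X} → Paths G k X → Fin k × Fin 3 → V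
  vertex (path {a = a} _ _ _) (zero , zero)           = a
  vertex (path {b = b} _ _ _) (zero , suc zero)       = b
  vertex (path {c = c} _ _ _) (zero , suc (suc zero)) = c
  vertex (path _ _ ps)        (suc i , t)             = vertex ps (i , t)

  vertex-∈ : ∀ {k X} (ps : Paths G k X) it → vertex ps it ∈ X
  vertex-∈ (path _ _ _)  (zero , zero)           = here refl
  vertex-∈ (path _ _ _)  (zero , suc zero)       = there (here refl)
  vertex-∈ (path _ _ _)  (zero , suc (suc zero)) = there (there (here refl))
  vertex-∈ (path _ _ ps) (suc i , t)             = there (there (there (vertex-∈ ps (i , t))))

  vertex-injective : ∀ {k X} (ps : Paths G k X) → Unique X → ∀ x y → vertex ps x ≡ vertex ps y → x ≡ y
  vertex-injective {X = a ∷ b ∷ c ∷ X} (path ab bc ps) ((a≢b ∷ a≢c ∷ a≢) ∷ (b≢c ∷ b≢) ∷ c≢ ∷ uniq) = inj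
    where
    fresh : ∀ t y → vertex (path {G = G} ab bc ps) (zero , t) ≢ vertex ps y
    fresh zero             y = All.lookup a≢ (vertex-∈ ps y)
    fresh (suc zero)       y = All.lookup b≢ (vertex-∈ ps y)
    fresh (suc (suc zero)) y = All.lookup c≢ (vertex-∈ ps y)

    inj : ∀ x y → vertex (path {G = G} ab bc ps) x ≡ vertex (path {G = G} ab bc ps) y → x ≡ y
    inj (suc i , t) (suc j , u) eq with refl ← vertex-injective ps uniq (i , t) (j , u) eq = refl
    inj (zero , t) (suc j , u) eq = contradiction eq (fresh t (j , u))
    inj (suc i , t) (zero , u) eq = contradiction (sym eq) (fresh u (i , t))
    inj (zero , zero)           (zero , zero)           _  = refl
    inj (zero , suc zero)       (zero , suc zero)       _  = refl
    inj (zero , suc (suc zero)) (zero , suc (suc zero)) _  = refl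
    inj (zero , zero)           (zero , suc zero)       eq = contradiction eq a≢b
    inj (zero , zero)           (zero , suc (suc zero)) eq = contradiction eq a≢c
    inj (zero , suc zero)       (zero , suc (suc zero)) eq = contradiction eq b≢c
    inj (zero , suc zero)       (zero , zero)           eq = contradiction (sym eq) a≢b
    inj (zero , suc (suc zero)) (zero , zero)           eq = contradiction (sym eq) a≢c
    inj (zero , suc (suc zero)) (zero , suc zero)       eq = contradiction (sym eq) b≢c

  vertex-adj : ∀ {k X} (ps : Paths G k X) i t u → adj P₃ t u ≡ true →
    adj G (vertex ps (i , t)) (vertex ps (i , u)) ≡ true
  vertex-adj (path ab bc ps) (suc i) t u eq = vertex-adj ps i t u eq
  vertex-adj (path ab bc ps) zero zero             (suc zero)       _ = ab
  vertex-adj (path ab bc ps) zero (suc zero)       zero             _ = _˘ G ab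
  vertex-adj (path ab bc ps) zero (suc zero)       (suc (suc zero)) _ = bc
  vertex-adj (path ab bc ps) zero (suc (suc zero)) (suc zero)       _ = _˘ G bc

  -- Disjointness of the paths is obtained here: `X ++ R` permutes a list without repetitions, so
  -- `X` has none.
  Packing⇒⊆ : ∀ {k L} → Unique L → Packing G k L → (k ·ᴳ P₃) ⊆ᴳ G
  Packing⇒⊆ {k} uniq (X , R , σ , ps) = vertex ps , vertex-injective ps uniq-X _ _ , pres
    where
    uniq-X : Unique X
    uniq-X = AllPairs-++⁻ˡ X (PermSetoid.Unique-resp-↭ (setoid V) (↭⇒↭ₛ σ) uniq)

    pres : ∀ x y → adj (k ·ᴳ P₃) x y ≡ true → adj G (vertex ps x) (vertex ps y) ≡ true
    pres (i , t) (j , u) eq with i ≟ j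
    ... | yes refl = vertex-adj ps i t u eq

-- The number of edges as defined by summation over increasing pairs

module _ {n : ℕ} (G : Graph (Fin n)) where

  up : Fin n → List (Fin n) → ℕ
  up i L = sum (map (λ j → if (toℕ i <ᵇ toℕ j) ∧ adj G i j then 1 else 0) L)

  <ᵇ-true : ∀ {m n} → m < n → (m <ᵇ n) ≡ true
  <ᵇ-true (s≤s z≤n)       = refl
  <ᵇ-true (s≤s (s≤s m<n)) = <ᵇ-true (s≤s m<n)

  <ᵇ-false : ∀ {m n} → n ≤ m → (m <ᵇ n) ≡ false
  <ᵇ-false z≤n       = refl
  <ᵇ-false (s≤s n≤m) = <ᵇ-false n≤m

  up≡deg : ∀ {i L} → All (λ j → toℕ i < toℕ j) L → up i L ≡ deg G i L
  up≡deg []          = refl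
  up≡deg (i<j ∷ i<L) rewrite <ᵇ-true i<j = cong (_ +_) (up≡deg i<L)

  up-skip : ∀ {i j} L → toℕ j ≤ toℕ i → up i (j ∷ L) ≡ up i L
  up-skip L j≤i rewrite <ᵇ-false j≤i = refl

  -- On an increasing list the inner sum at i vanishes on all entries up to i and shrinks to the
  -- degree of i into the tail.
  sum-up : ∀ {L} → AllPairs (λ i j → toℕ i < toℕ j) L → sum (map (λ i → up i L) L) ≡ edges G L
  sum-up []                       = refl
  sum-up {i ∷ L} (i<L ∷ sorted) = cong₂ _+_
    (≡-trans (up-skip L ≤-refl) (up≡deg i<L))
    (≡-trans (cong sum (map-cong-local (All.map (λ i<j → up-skip L (<⇒≤ i<j)) i<L))) (sum-up sorted))

  e≡edges : e G ≡ edges G (allFin n)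
  e≡edges = sum-up (tabulate⁺-< id)

theorem1p3 : (k n : ℕ) → 2 ≤ k → 11 * k * k + 4 * k ∸ 3 ≤ 2 * n →
    (G : Graph (Fin n)) → (2 * k ∸ 3) * n < 2 * e G →
    ¬ (G ⊆ᴳ F₂ n k) →
    ¬ (Σ ℕ λ h → 4 ≤ h × h ≤ 5 × (G ⊆ᴳ F n (k ∸ 1) (K h))) →
    ¬ (G ⊆ᴳ F n (k ∸ 1) N₆) →
    (k ·ᴳ P₃) ⊆ᴳ G
theorem1p3 (suc (suc j)) n (s≤s (s≤s z≤n)) large G many ¬clique₂ ¬clique ¬net =
  [ Packing⇒⊆ G (allFin⁺ n) , ⊥-elim ∘ exceptional ]′ (outcome G j (allFin n) N≤n many′)
  where
  length≡n : length (allFin n) ≡ n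
  length≡n = length-tabulate id

  N≤n : 24 + 18 * j ≤ length (allFin n)
  N≤n = subst (24 + 18 * j ≤_) (sym length≡n) (size-start j n large)

  many′ : (1 + 2 * j) * length (allFin n) < 2 * edges G (allFin n)
  many′ = begin-strict
    (1 + 2 * j) * length (allFin n) ≡⟨ cong ((1 + 2 * j) *_) length≡n ⟩
    -- For k = j + 2, 2k is 4 + 2j, so subtracting 3 does not truncate.
    (1 + 2 * j) * n                 ≡⟨ cong (λ m → (m ∸ 3) * n) (*-distribˡ-+ 2 2 j) ⟨
    (2 * (2 + j) ∸ 3) * n           <⟨ many ⟩
    2 * e G                         ≡⟨ cong (2 *_) (e≡edges G) ⟩
    2 * edges G (allFin n)          ∎
    where open ≤-Reasoning

  exceptional : ¬ Exceptional G j (allFin n)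
  exceptional (clique₂ S) = ¬clique₂ (Structure⇒⊆F G length≡n ∈-allFin S)
  exceptional (clique₄ S) = ¬clique (4 , ≤-refl , n≤1+n 4 , Structure⇒⊆F G length≡n ∈-allFin S)
  exceptional (clique₅ S) = ¬clique (5 , n≤1+n 4 , ≤-refl , Structure⇒⊆F G length≡n ∈-allFin S)
  exceptional (net S)     = ¬net (Structure⇒⊆F G length≡n ∈-allFin S)
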